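{- There is no homomorphic map from MuACL to MuACL$^0$ that is both complete and correct.
   Context: Fix finite sets $\mathit{Res}$ of resources and $\mathit{Usr}$ of users, and a set of predicate symbols $p$ with arities. MuACL propositions are of four kinds ($\multimap\!\!\multimap$ is a primitive binary connective, "linear contractual implication"): $\sigma ::= I \mid res@usr \mid \sigma\otimes\sigma$; $\delta ::= I \mid res@usr\multimap res'@usr' \mid \delta\otimes\delta$; $\theta ::= \delta \multimap\!\!\multimap \delta$; $\omega ::= \top \mid p(usr_1,\dots,usr_n) \mid \omega\land\omega \mid \omega\to\omega \mid G(\theta) \mid G(\delta)$. Since $\otimes$ is associative and commutative, tensor products are identified with multisets of their factors, $I$ being the empty multiset; $\delta\subseteq\delta'$ is multiset inclusion. $\Sigma,\Delta,\Theta,\Omega$ (possibly primed) are finite multisets of propositions $\sigma,\delta,\theta,\omega$ respectively; comma is multiset union. Judgments are $\Omega\Vdash\omega$ and sequents $\Omega;\Theta,\Delta,\Sigma\vdash\sigma$; empty components are omitted. Below $\Gamma$ abbreviates $\Theta,\Delta,\Sigma$, $\Gamma'$ abbreviates $\Theta',\Delta',\Sigma'$, and "premises / conclusion" denotes a rule. The rules of MuACL are: Non-linear: ($\top$-right) $\Vdash\top$. ($\Omega$-Ax) $\omega\Vdash\omega$. (Cont) $\Omega,\omega,\omega\Vdash\omega'$ / $\Omega,\omega\Vdash\omega'$. (Weak) $\Omega\Vdash\omega'$ / $\Omega,\omega\Vdash\omega'$. ($\land$-left1) $\Omega,\omega\Vdash\omega''$ / $\Omega,\omega\land\omega'\Vdash\omega''$.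 ($\land$-left2) $\Omega,\omega'\Vdash\omega''$ / $\Omega,\omega\land\omega'\Vdash\omega''$. ($\land$-right) $\Omega\Vdash\omega$ and $\Omega'\Vdash\omega'$ / $\Omega,\Omega'\Vdash\omega\land\omega'$. ($\to$-left) $\Omega\Vdash\omega$ and $\Omega',\omega'\Vdash\omega''$ / $\Omega,\omega\to\omega',\Omega'\Vdash\omega''$. ($\to$-right) $\Omega,\omega\Vdash\omega'$ / $\Omega\Vdash\omega\to\omega'$. Non-linear L-rules: (L-Cont) $\Omega,\omega,\omega;\Gamma\vdash\sigma$ / $\Omega,\omega;\Gamma\vdash\sigma$. (L-Weak) $\Omega;\Gamma\vdash\sigma$ / $\Omega,\omega;\Gamma\vdash\sigma$. (L-$\land$-left1) $\Omega,\omega;\Gamma\vdash\sigma$ / $\Omega,\omega\land\omega';\Gamma\vdash\sigma$. (L-$\land$-left2) $\Omega,\omega';\Gamma\vdash\sigma$ / $\Omega,\omega\land\omega';\Gamma\vdash\sigma$. (L-$\to$-left) $\Omega\Vdash\omega$ and $\Omega',\omega';\Gamma\vdash\sigma$ / $\Omega,\omega\to\omega',\Omega';\Gamma\vdash\sigma$. Linear: ($I$-right) $\vdash I$. ($\Sigma$-Ax) $\Omega;res@usr\vdash res@usr$. ($\otimes$-left-$\Theta$), ($\otimes$-left-$\Delta$), ($\otimes$-left-$\Sigma$): from a sequent with $x,y$ among its left linear formulas of kind $\theta$, $\delta$, $\sigma$ respectively, infer the same sequent with $x\otimes y$ in place of $x,y$. ($\otimes$-right) $\Omega;\Gamma\vdash\sigma$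 and $\Omega;\Gamma'\vdash\sigma'$ / $\Omega;\Gamma,\Gamma'\vdash\sigma\otimes\sigma'$. ($\multimap$-left) $\Omega;\Sigma\vdash res@usr$ / $\Omega;\Sigma,res@usr\multimap res'@usr'\vdash res'@usr'$. ($\multimap\!\!\multimap$-left) if $\delta\subseteq\delta'$: $\Omega;\Theta,\Delta,\delta',\Sigma\vdash\sigma$ / $\Omega;\Theta,\delta\multimap\!\!\multimap\delta',\Delta,\Sigma\vdash\sigma$. ($\multimap\!\!\multimap$-split) $\Omega;\Theta,(\delta\otimes\delta'')\multimap\!\!\multimap(\delta'\otimes\delta'''),\Delta,\Sigma\vdash\sigma$ / $\Omega;\Theta,\delta\multimap\!\!\multimap\delta',\delta''\multimap\!\!\multimap\delta''',\Delta,\Sigma\vdash\sigma$. Interaction: ($G$-left-$\theta$) $\Omega;\Theta,\theta,\Delta,\Sigma\vdash\sigma$ / $\Omega,G(\theta);\Theta,\Delta,\Sigma\vdash\sigma$. ($G$-left-$\delta$) $\Omega;\Theta,\Delta,\delta,\Sigma\vdash\sigma$ / $\Omega,G(\delta);\Theta,\Delta,\Sigma\vdash\sigma$. ($\Omega$-cut) $\Omega\Vdash\omega$ and $\Omega',\omega;\Gamma\vdash\sigma$ / $\Omega,\Omega';\Gamma\vdash\sigma$. $\vdash_{\mathrm{MuACL}}$ means that the sequent is valid in MuACL (has a finite proof all of whose leaves are axioms). MuACL$^0$ is the logic obtained from MuACL by removing all formulas containing $\multimap\!\!\multimap$ and the two rules ($\multimap\!\!\multimap$-left), ($\multimap\!\!\multimap$-split).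 A homomorphic map from MuACL to MuACL$^0$ is a function $m$ from MuACL propositions to MuACL$^0$ propositions such that $m(\varphi)=\varphi$ if $\varphi$ is $I$, $\top$, $res@usr$ or $p(usr_1,\dots,usr_n)$; $m(\varphi\star\varphi')=m(\varphi)\star m(\varphi')$ for $\star\in\{\otimes,\multimap,\land,\to\}$; and $m(G(\varphi))=G(m(\varphi))$. There is no constraint on how $m$ maps propositions with top-level operator $\multimap\!\!\multimap$, besides the values being MuACL$^0$ propositions and the clause for $G$ making sense. The map $m$ is applied elementwise to multisets. It is complete if for all $\Omega,\Theta,\Delta,\Sigma,\sigma$: $\Omega;\Theta,\Delta,\Sigma\vdash_{\mathrm{MuACL}}\sigma$ implies $m(\Omega);m(\Theta),m(\Delta),m(\Sigma)\vdash_{\mathrm{MuACL}}m(\sigma)$. It is correct if for all $\Omega,\Theta,\Delta,\Sigma,\sigma$: $m(\Omega);m(\Theta),m(\Delta),m(\Sigma)\vdash_{\mathrm{MuACL}}m(\sigma)$ implies $\Omega;\Theta,\Delta,\Sigma\vdash_{\mathrm{MuACL}}\sigma$. (In the image sequents each formula is placed in the component corresponding to its syntactic kind.) -}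

module Defs where

open import Data.List.Base using (List; []; _∷_; [_]; _++_; map)
open import Data.List.Relation.Binary.Permutation.Homogeneous using (Permutation)
open import Data.Nat.Base using (ℕ)
open import Data.Fin.Base using (Fin)
open import Data.Product.Base using (∃-syntax; _×_)
open import Data.Vec.Base using (Vec)
open import Function.Bundles using (_↔_)
open import Level using (0ℓ)
open import Relation.Binary.Core using (Rel)
open import Relation.Binary.PropositionalEquality.Core using (_≡_)

Finite : Set → Set
Finite A = ∃[ n ] (A ↔ Fin n)

infixr 7 _⊗_

data Tensor (A : Set) : Set where
  I    : Tensor A
  ⟨_⟩  : A → Tensor A
  _⊗_  : Tensor A → Tensor A → Tensor A

factors : ∀ {A} → Tensor A → List A
factors I       = []
factors ⟨ a ⟩   = [ a ]
factors (s ⊗ t) = factors s ++ factors t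

-- Tensor products are identified with multisets of their factors, the factors
-- themselves being identified by R.
Tensor≈ : ∀ {A} → Rel A 0ℓ → Rel (Tensor A) 0ℓ
Tensor≈ R s t = Permutation R (factors s) (factors t)

module MuACL (Res Usr Pred : Set) (arity : Pred → ℕ) where

  infix  9 _＠_
  infix  8 _⊸_
  infix  6 _⊸⊸_
  infixr 5 _∧_
  infixr 4 _⇒_
  infix  3 _≈σ_ _≈δ_ _≈θ_ _≈ω_ _⊆_
  infix  2 _⊩_ _⨟_∣_∣_⊢_

  record Atom : Set where
    constructor _＠_
    field
      res : Res
      usr : Usr

  record Lollipop : Set where
    constructor _⊸_
    field
      source target : Atom

  σProp δProp : Set
  σProp = Tensor Atom
  δProp = Tensor Lollipop

  record θProp : Set where
    constructor _⊸⊸_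
    field
      required offered : δProp

  data ωProp : Set where
    ⊤    : ωProp
    pred : (p : Pred) → Vec Usr (arity p) → ωProp
    _∧_  : ωProp → ωProp → ωProp
    _⇒_  : ωProp → ωProp → ωProp
    Gθ   : θProp → ωProp
    Gδ   : δProp → ωProp

  -- _≈σ_, …, _≈ω_ are the equality of propositions once tensor products are
  -- read as multisets.

  _≈σ_ : Rel σProp 0ℓ
  _≈σ_ = Tensor≈ _≡_

  _≈δ_ : Rel δProp 0ℓ
  _≈δ_ = Tensor≈ _≡_

  _≈θ_ : Rel θProp 0ℓ
  (δ₁ ⊸⊸ δ₂) ≈θ (δ₁′ ⊸⊸ δ₂′) = δ₁ ≈δ δ₁′ × δ₂ ≈δ δ₂′

  data _≈ω_ : Rel ωProp 0ℓ where
    ⊤≈    : ⊤ ≈ω ⊤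
    pred≈ : ∀ {p us} → pred p us ≈ω pred p us
    ∧≈    : ∀ {ω₁ ω₂ ω₁′ ω₂′} → ω₁ ≈ω ω₁′ → ω₂ ≈ω ω₂′ → (ω₁ ∧ ω₂) ≈ω (ω₁′ ∧ ω₂′)
    ⇒≈    : ∀ {ω₁ ω₂ ω₁′ ω₂′} → ω₁ ≈ω ω₁′ → ω₂ ≈ω ω₂′ → (ω₁ ⇒ ω₂) ≈ω (ω₁′ ⇒ ω₂′)
    Gθ≈   : ∀ {θ θ′} → θ ≈θ θ′ → Gθ θ ≈ω Gθ θ′
    Gδ≈   : ∀ {δ δ′} → δ ≈δ δ′ → Gδ δ ≈ω Gδ δ′

  _⊆_ : Rel δProp 0ℓ
  δ ⊆ δ′ = ∃[ δ″ ] (δ ⊗ δ″ ≈δ δ′)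

  -- Contexts are lists; the rules Exch and L-Exch turn them into multisets of
  -- propositions taken up to the identifications above.

  data _⊩_ : List ωProp → ωProp → Set where
    Exch     : ∀ {Ω Ω′ ω ω′} → Permutation _≈ω_ Ω Ω′ → ω ≈ω ω′ → Ω ⊩ ω → Ω′ ⊩ ω′
    ⊤-right  : [] ⊩ ⊤
    Ω-Ax     : ∀ {ω} → [ ω ] ⊩ ω
    Cont     : ∀ {Ω ω ω′} → ω ∷ ω ∷ Ω ⊩ ω′ → ω ∷ Ω ⊩ ω′
    Weak     : ∀ {Ω ω ω′} → Ω ⊩ ω′ → ω ∷ Ω ⊩ ω′
    ∧-left₁  : ∀ {Ω ω ω′ ω″} → ω ∷ Ω ⊩ ω″ → (ω ∧ ω′) ∷ Ω ⊩ ω″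
    ∧-left₂  : ∀ {Ω ω ω′ ω″} → ω′ ∷ Ω ⊩ ω″ → (ω ∧ ω′) ∷ Ω ⊩ ω″
    ∧-right  : ∀ {Ω Ω′ ω ω′} → Ω ⊩ ω → Ω′ ⊩ ω′ → Ω ++ Ω′ ⊩ (ω ∧ ω′)
    ⇒-left   : ∀ {Ω Ω′ ω ω′ ω″} → Ω ⊩ ω → ω′ ∷ Ω′ ⊩ ω″ → (ω ⇒ ω′) ∷ (Ω ++ Ω′) ⊩ ω″
    ⇒-right  : ∀ {Ω ω ω′} → ω ∷ Ω ⊩ ω′ → Ω ⊩ (ω ⇒ ω′)

  -- Ω ⨟ Θ ∣ Δ ∣ Σ ⊢ σ is the sequent Ω; Θ, Δ, Σ ⊢ σ.  There are no tensor
  -- products of contracts among the θ-propositions, but ⊗-left-Θ forms them on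
  -- the left of a sequent; hence Θ ranges over tensors, a θ-proposition
  -- occurring in it as ⟨ θ ⟩.
  data _⨟_∣_∣_⊢_ : List ωProp → List (Tensor θProp) → List δProp → List σProp →
                   σProp → Set where
    L-Exch : ∀ {Ω Ω′ Θ Θ′ Δ Δ′ Σ Σ′ σ σ′} →
             Permutation _≈ω_ Ω Ω′ → Permutation (Tensor≈ _≈θ_) Θ Θ′ →
             Permutation _≈δ_ Δ Δ′ → Permutation _≈σ_ Σ Σ′ → σ ≈σ σ′ →
             Ω ⨟ Θ ∣ Δ ∣ Σ ⊢ σ → Ω′ ⨟ Θ′ ∣ Δ′ ∣ Σ′ ⊢ σ′

    L-Cont    : ∀ {Ω Θ Δ Σ σ ω} →
                ω ∷ ω ∷ Ω ⨟ Θ ∣ Δ ∣ Σ ⊢ σ → ω ∷ Ω ⨟ Θ ∣ Δ ∣ Σ ⊢ σ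
    L-Weak    : ∀ {Ω Θ Δ Σ σ ω} →
                Ω ⨟ Θ ∣ Δ ∣ Σ ⊢ σ → ω ∷ Ω ⨟ Θ ∣ Δ ∣ Σ ⊢ σ
    L-∧-left₁ : ∀ {Ω Θ Δ Σ σ ω ω′} →
                ω ∷ Ω ⨟ Θ ∣ Δ ∣ Σ ⊢ σ → (ω ∧ ω′) ∷ Ω ⨟ Θ ∣ Δ ∣ Σ ⊢ σ
    L-∧-left₂ : ∀ {Ω Θ Δ Σ σ ω ω′} →
                ω′ ∷ Ω ⨟ Θ ∣ Δ ∣ Σ ⊢ σ → (ω ∧ ω′) ∷ Ω ⨟ Θ ∣ Δ ∣ Σ ⊢ σ
    L-⇒-left  : ∀ {Ω Ω′ Θ Δ Σ σ ω ω′} →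
                Ω ⊩ ω → ω′ ∷ Ω′ ⨟ Θ ∣ Δ ∣ Σ ⊢ σ →
                (ω ⇒ ω′) ∷ (Ω ++ Ω′) ⨟ Θ ∣ Δ ∣ Σ ⊢ σ

    I-right   : [] ⨟ [] ∣ [] ∣ [] ⊢ I
    Σ-Ax      : ∀ {Ω r u} → Ω ⨟ [] ∣ [] ∣ [ ⟨ r ＠ u ⟩ ] ⊢ ⟨ r ＠ u ⟩
    ⊗-left-Θ  : ∀ {Ω Θ Δ Σ σ x y} →
                Ω ⨟ x ∷ y ∷ Θ ∣ Δ ∣ Σ ⊢ σ → Ω ⨟ (x ⊗ y) ∷ Θ ∣ Δ ∣ Σ ⊢ σ
    ⊗-left-Δ  : ∀ {Ω Θ Δ Σ σ x y} →
                Ω ⨟ Θ ∣ x ∷ y ∷ Δ ∣ Σ ⊢ σ → Ω ⨟ Θ ∣ (x ⊗ y) ∷ Δ ∣ Σ ⊢ σ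
    ⊗-left-Σ  : ∀ {Ω Θ Δ Σ σ x y} →
                Ω ⨟ Θ ∣ Δ ∣ x ∷ y ∷ Σ ⊢ σ → Ω ⨟ Θ ∣ Δ ∣ (x ⊗ y) ∷ Σ ⊢ σ
    ⊗-right   : ∀ {Ω Θ Θ′ Δ Δ′ Σ Σ′ σ σ′} →
                Ω ⨟ Θ ∣ Δ ∣ Σ ⊢ σ → Ω ⨟ Θ′ ∣ Δ′ ∣ Σ′ ⊢ σ′ →
                Ω ⨟ Θ ++ Θ′ ∣ Δ ++ Δ′ ∣ Σ ++ Σ′ ⊢ (σ ⊗ σ′)
    ⊸-left    : ∀ {Ω Σ r u r′ u′} →
                Ω ⨟ [] ∣ [] ∣ Σ ⊢ ⟨ r ＠ u ⟩ →
                Ω ⨟ [] ∣ [ ⟨ r ＠ u ⊸ r′ ＠ u′ ⟩ ] ∣ Σ ⊢ ⟨ r′ ＠ u′ ⟩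
    ⊸⊸-left   : ∀ {Ω Θ Δ Σ σ δ δ′} → δ ⊆ δ′ →
                Ω ⨟ Θ ∣ δ′ ∷ Δ ∣ Σ ⊢ σ → Ω ⨟ ⟨ δ ⊸⊸ δ′ ⟩ ∷ Θ ∣ Δ ∣ Σ ⊢ σ
    ⊸⊸-split  : ∀ {Ω Θ Δ Σ σ δ δ′ δ″ δ‴} →
                Ω ⨟ ⟨ (δ ⊗ δ″) ⊸⊸ (δ′ ⊗ δ‴) ⟩ ∷ Θ ∣ Δ ∣ Σ ⊢ σ →
                Ω ⨟ ⟨ δ ⊸⊸ δ′ ⟩ ∷ ⟨ δ″ ⊸⊸ δ‴ ⟩ ∷ Θ ∣ Δ ∣ Σ ⊢ σ

    G-left-θ  : ∀ {Ω Θ Δ Σ σ θ} →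
                Ω ⨟ ⟨ θ ⟩ ∷ Θ ∣ Δ ∣ Σ ⊢ σ → Gθ θ ∷ Ω ⨟ Θ ∣ Δ ∣ Σ ⊢ σ
    G-left-δ  : ∀ {Ω Θ Δ Σ σ δ} →
                Ω ⨟ Θ ∣ δ ∷ Δ ∣ Σ ⊢ σ → Gδ δ ∷ Ω ⨟ Θ ∣ Δ ∣ Σ ⊢ σ
    Ω-cut     : ∀ {Ω Ω′ Θ Δ Σ σ ω} →
                Ω ⊩ ω → ω ∷ Ω′ ⨟ Θ ∣ Δ ∣ Σ ⊢ σ → Ω ++ Ω′ ⨟ Θ ∣ Δ ∣ Σ ⊢ σ

  -- The ω-propositions of MuACL⁰, i.e. those without ⊸⊸.  Every σ- and
  -- δ-proposition belongs to MuACL⁰, and no θ-proposition does.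
  data ⊸⊸-Free : ωProp → Set where
    ⊤    : ⊸⊸-Free ⊤
    pred : ∀ {p us} → ⊸⊸-Free (pred p us)
    _∧_  : ∀ {ω ω′} → ⊸⊸-Free ω → ⊸⊸-Free ω′ → ⊸⊸-Free (ω ∧ ω′)
    _⇒_  : ∀ {ω ω′} → ⊸⊸-Free ω → ⊸⊸-Free ω′ → ⊸⊸-Free (ω ⇒ ω′)
    Gδ   : ∀ {δ} → ⊸⊸-Free (Gδ δ)

  -- The map is given by its restrictions to the four kinds of propositions.  It
  -- sends a θ to a δ because m (G θ) = G (m θ) has to be a proposition of MuACL⁰,
  -- where G applies to δ-propositions only.
  record HomomorphicMap : Set where
    field
      mσ : σProp → σProp
      mδ : δProp → δProp
      mθ : θProp → δProp
      mω : ωProp → ωProp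

      mω-free : ∀ ω → ⊸⊸-Free (mω ω)

      mσ-cong : ∀ {σ σ′} → σ ≈σ σ′ → mσ σ ≈σ mσ σ′
      mδ-cong : ∀ {δ δ′} → δ ≈δ δ′ → mδ δ ≈δ mδ δ′
      mθ-cong : ∀ {θ θ′} → θ ≈θ θ′ → mθ θ ≈δ mθ θ′
      mω-cong : ∀ {ω ω′} → ω ≈ω ω′ → mω ω ≈ω mω ω′

      mσ-I    : mσ I ≈σ I
      mσ-atom : ∀ r u → mσ ⟨ r ＠ u ⟩ ≈σ ⟨ r ＠ u ⟩
      mσ-⊗    : ∀ σ σ′ → mσ (σ ⊗ σ′) ≈σ mσ σ ⊗ mσ σ′

      mδ-I    : mδ I ≈δ I
      -- m (a ⊸ b) = m a ⊸ m b, where m fixes the atoms a and b.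
      mδ-⊸    : ∀ a b → mδ ⟨ a ⊸ b ⟩ ≈δ ⟨ a ⊸ b ⟩
      mδ-⊗    : ∀ δ δ′ → mδ (δ ⊗ δ′) ≈δ mδ δ ⊗ mδ δ′

      mω-⊤    : mω ⊤ ≈ω ⊤
      mω-pred : ∀ p us → mω (pred p us) ≈ω pred p us
      mω-∧    : ∀ ω ω′ → mω (ω ∧ ω′) ≈ω (mω ω ∧ mω ω′)
      mω-⇒    : ∀ ω ω′ → mω (ω ⇒ ω′) ≈ω (mω ω ⇒ mω ω′)
      mω-Gθ   : ∀ θ → mω (Gθ θ) ≈ω Gδ (mθ θ)
      mω-Gδ   : ∀ δ → mω (Gδ δ) ≈ω Gδ (mδ δ)

  module _ (m : HomomorphicMap) where
    open HomomorphicMap m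

    -- In the image sequent m(Θ) consists of δ-propositions and joins m(Δ).

    Complete : Set
    Complete = ∀ Ω (Θ : List θProp) Δ Σ σ →
      Ω ⨟ map ⟨_⟩ Θ ∣ Δ ∣ Σ ⊢ σ →
      map mω Ω ⨟ [] ∣ map mθ Θ ++ map mδ Δ ∣ map mσ Σ ⊢ mσ σ

    Correct : Set
    Correct = ∀ Ω (Θ : List θProp) Δ Σ σ →
      map mω Ω ⨟ [] ∣ map mθ Θ ++ map mδ Δ ∣ map mσ Σ ⊢ mσ σ →
      Ω ⨟ map ⟨_⟩ Θ ∣ Δ ∣ Σ ⊢ σ

{-# OPTIONS --safe #-}

-- Let l = a ⊸ a.  The contracts l ⊸⊸ I and I ⊸⊸ l together yield l, but l ⊸⊸ I
-- alone is unusable: for empty Ω, the contracts of a provable sequent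
-- never require more lollipops than they offer.  MuACL⁰ cannot express such a debt:
-- every non-empty tensor of lollipops is usable, with its sources as resources.
-- The image of l ⊸⊸ I is non-empty by completeness, since I has no left rule; hence
-- it is usable on its own, against correctness.
module Submission where

open import Defs
open import Data.Empty using (⊥)
open import Data.List.Base using (List; []; _∷_; [_]; _++_; foldl; foldr; map)
open import Data.List.Properties using (++-assoc; ++-identityʳ; map-++)
open import Data.List.Relation.Binary.Permutation.Homogeneous as Homogeneous
  using (Permutation; refl; prep; swap; trans)
import Data.List.Relation.Binary.Permutation.Setoid.Properties as Permutationₛ
open import Data.List.Relation.Binary.Pointwise as Pointwise using (Pointwise; []; _∷_)
open import Data.List.Relation.Unary.All using (All; []; _∷_)
open import Data.List.Relation.Unary.All.Properties using (++⁺; ++⁻)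
open import Data.Nat.Base using (ℕ; _+_; _≤_; _<_; z≤n; s≤s)
open import Data.Nat.ListAction using (sum)
open import Data.Nat.ListAction.Properties using (sum-++)
open import Data.Nat.Properties
  using (+-0-isCommutativeMonoid; +-assoc; +-identityʳ; +-mono-≤; +-monoˡ-≤;
         <-≤-trans; m≤m+n; ≤-reflexive; ≤-trans)
open import Data.Product.Base using (∃-syntax; _×_; _,_)
open import Data.Unit.Base as Unit using (tt)
open import Function.Base using (_∘_; _on_; const; id)
open import Relation.Binary.Core using (Rel; _=[_]⇒_)
import Relation.Binary.Construct.On as On
open import Relation.Binary.Definitions using (_Respects_)
open import Relation.Binary.PropositionalEquality
  using (_≡_; cong; cong₂; setoid; subst; subst₂; sym; module ≡-Reasoning)
  renaming (refl to ≡-refl; trans to ≡-trans)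
open import Relation.Nullary.Negation.Core using (¬_)

-- Predicates and sums along permutations.

module _ {a r} {A : Set a} {R : Rel A r} where

  All-resp-Permutation : ∀ {p} {P : A → Set p} → P Respects R →
                         All P Respects Permutation R
  All-resp-Permutation resp (refl [])           []             = []
  All-resp-Permutation resp (refl (eq ∷ eqs))   (px ∷ pxs)     =
    resp eq px ∷ All-resp-Permutation resp (refl eqs) pxs
  All-resp-Permutation resp (prep eq π)         (px ∷ pxs)     =
    resp eq px ∷ All-resp-Permutation resp π pxs
  All-resp-Permutation resp (swap eq₁ eq₂ π)    (px ∷ py ∷ ps) =
    resp eq₂ py ∷ resp eq₁ px ∷ All-resp-Permutation resp π ps
  All-resp-Permutation resp (trans π₁ π₂)                      =
    All-resp-Permutation resp π₂ ∘ All-resp-Permutation resp π₁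

  -- `R` is an arbitrary relation, so it is first coarsened to equality of `f`-values, which forms a
  -- setoid.
  sum-map-Permutation : (f : A → ℕ) → R =[ f ]⇒ _≡_ →
                        Permutation R =[ sum ∘ map f ]⇒ _≡_
  sum-map-Permutation f f-cong π =
    Permutationₛ.foldr-commMonoid (setoid ℕ) +-0-isCommutativeMonoid
      (Permutationₛ.map⁺ (On.setoid (setoid ℕ) f) (setoid ℕ) id
        (Homogeneous.map f-cong π))

sum-map-++ : ∀ {A : Set} (f : A → ℕ) xs ys →
             sum (map f (xs ++ ys)) ≡ sum (map f xs) + sum (map f ys)
sum-map-++ f xs ys =
  ≡-trans (cong sum (map-++ f xs ys)) (sum-++ (map f xs) (map f ys))

≡⇒Permutation : ∀ {A : Set} {xs ys : List A} → xs ≡ ys → Permutation _≡_ xs ys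
≡⇒Permutation ≡-refl = refl (Pointwise.refl ≡-refl)

weight : ∀ {A} → (A → ℕ) → Tensor A → ℕ
weight f t = sum (map f (factors t))

weight-⊗ : ∀ {A} (f : A → ℕ) s t → weight f (s ⊗ t) ≡ weight f s + weight f t
weight-⊗ f s t = sum-map-++ f (factors s) (factors t)

size : ∀ {A} → Tensor A → ℕ
size = weight (const 1)

size-cong : ∀ {A} (s t : Tensor A) → Tensor≈ _≡_ s t → size s ≡ size t
size-cong _ _ = sum-map-Permutation (const 1) (const ≡-refl)

factors-foldl-⊗ : ∀ {A} (t : Tensor A) xs →
                  factors (foldl _⊗_ t (map ⟨_⟩ xs)) ≡ factors t ++ xs
factors-foldl-⊗ t []       = sym (++-identityʳ (factors t))
factors-foldl-⊗ t (x ∷ xs) =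
  ≡-trans (factors-foldl-⊗ (t ⊗ ⟨ x ⟩) xs) (++-assoc (factors t) [ x ] xs)

-- Semantics of the non-linear judgment.

module _ {Res Usr Pred : Set} {arity : Pred → ℕ} where
  open MuACL Res Usr Pred arity
  open Lollipop
  open θProp

  -- G is read as falsity: no commitment G φ follows from nothing, even by Ω-cut.
  ⟦_⟧ : ωProp → Set
  ⟦ ⊤ ⟧         = Unit.⊤
  ⟦ pred _ _ ⟧  = Unit.⊤
  ⟦ ω ∧ ω′ ⟧    = ⟦ ω ⟧ × ⟦ ω′ ⟧
  ⟦ ω ⇒ ω′ ⟧    = ⟦ ω ⟧ → ⟦ ω′ ⟧
  ⟦ Gθ _ ⟧      = ⊥
  ⟦ Gδ _ ⟧      = ⊥

  -- Tensors occur in an ω-proposition only under `G`, whose argument the interpretation ignores.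
  -- Equality of types is reversible, which serves the left side of `⇒` and `⟦⟧-resp⁻`.
  ⟦⟧-cong : ∀ {ω ω′} → ω ≈ω ω′ → ⟦ ω ⟧ ≡ ⟦ ω′ ⟧
  ⟦⟧-cong ⊤≈       = ≡-refl
  ⟦⟧-cong pred≈    = ≡-refl
  ⟦⟧-cong (∧≈ p q) = cong₂ _×_ (⟦⟧-cong p) (⟦⟧-cong q)
  ⟦⟧-cong (⇒≈ p q) = cong₂ (λ A B → A → B) (⟦⟧-cong p) (⟦⟧-cong q)
  ⟦⟧-cong (Gθ≈ _)  = ≡-refl
  ⟦⟧-cong (Gδ≈ _)  = ≡-refl

  ⟦⟧-resp : ⟦_⟧ Respects _≈ω_
  ⟦⟧-resp eq = subst id (⟦⟧-cong eq)

  ⟦⟧-resp⁻ : ∀ {Ω Ω′} → Permutation _≈ω_ Ω Ω′ → All ⟦_⟧ Ω′ → All ⟦_⟧ Ω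
  ⟦⟧-resp⁻ π = All-resp-Permutation {R = _≡_ on ⟦_⟧} (subst id)
                 (Homogeneous.sym sym (Homogeneous.map ⟦⟧-cong π))

  -- Takes the place of cut elimination: whatever `Ω-cut` and `L-⇒-left` add to a true `Ω` is again
  -- true, so no `G` formula can become a member of it.
  ⊩-sound : ∀ {Ω ω} → Ω ⊩ ω → All ⟦_⟧ Ω → ⟦ ω ⟧
  ⊩-sound (Exch π eq d)      γ             = ⟦⟧-resp eq (⊩-sound d (⟦⟧-resp⁻ π γ))
  ⊩-sound ⊤-right            _             = tt
  ⊩-sound Ω-Ax               (x ∷ [])      = x
  ⊩-sound (Cont d)           (x ∷ γ)       = ⊩-sound d (x ∷ x ∷ γ)
  ⊩-sound (Weak d)           (_ ∷ γ)       = ⊩-sound d γ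
  ⊩-sound (∧-left₁ d)        ((x , _) ∷ γ) = ⊩-sound d (x ∷ γ)
  ⊩-sound (∧-left₂ d)        ((_ , y) ∷ γ) = ⊩-sound d (y ∷ γ)
  ⊩-sound (∧-right {Ω} d d′) γ             =
    let γ₁ , γ₂ = ++⁻ Ω γ in ⊩-sound d γ₁ , ⊩-sound d′ γ₂
  ⊩-sound (⇒-left {Ω} d d′)  (f ∷ γ)       =
    let γ₁ , γ₂ = ++⁻ Ω γ in ⊩-sound d′ (f (⊩-sound d γ₁) ∷ γ₂)
  ⊩-sound (⇒-right d)        γ             = λ x → ⊩-sound d (x ∷ γ)

  -- Invariants of provable sequents.

  NonEmpty : δProp → Set
  NonEmpty δ = 0 < size δ

  nonEmpty-⊗ : ∀ δ δ′ → NonEmpty δ → NonEmpty (δ ⊗ δ′)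
  nonEmpty-⊗ δ δ′ 0<δ =
    <-≤-trans 0<δ (≤-trans (m≤m+n _ _) (≤-reflexive (sym (weight-⊗ (const 1) δ δ′))))

  total : (θProp → ℕ) → List (Tensor θProp) → ℕ
  total f Θ = sum (map (weight f) Θ)

  total-⊗ : ∀ f x y Θ → total f (x ∷ y ∷ Θ) ≡ total f ((x ⊗ y) ∷ Θ)
  total-⊗ f x y Θ = begin
    weight f x + (weight f y + total f Θ)  ≡⟨ +-assoc (weight f x) _ _ ⟨
    weight f x + weight f y + total f Θ    ≡⟨ cong (_+ total f Θ) (weight-⊗ f x y) ⟨
    weight f (x ⊗ y) + total f Θ           ∎
    where open ≡-Reasoning

  total-merge : ∀ f θ₁ θ₂ θ Θ → f θ ≡ f θ₁ + f θ₂ →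
                total f (⟨ θ ⟩ ∷ Θ) ≡ total f (⟨ θ₁ ⟩ ∷ ⟨ θ₂ ⟩ ∷ Θ)
  total-merge f θ₁ θ₂ θ Θ eq = begin
    f θ + 0 + total f Θ                ≡⟨ cong (_+ total f Θ) (+-identityʳ (f θ)) ⟩
    f θ + total f Θ                    ≡⟨ cong (_+ total f Θ) eq ⟩
    f θ₁ + f θ₂ + total f Θ            ≡⟨ +-assoc (f θ₁) _ _ ⟩
    f θ₁ + (f θ₂ + total f Θ)          ≡⟨ cong₂ (λ m n → m + (n + total f Θ))
                                            (+-identityʳ (f θ₁)) (+-identityʳ (f θ₂)) ⟨
    f θ₁ + 0 + (f θ₂ + 0 + total f Θ)  ∎
    where open ≡-Reasoning

  total-cong : ∀ f → _≈θ_ =[ f ]⇒ _≡_ →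
               Permutation (Tensor≈ _≈θ_) =[ total f ]⇒ _≡_
  -- The inner permutation acts on the factors of one tensor, the outer one on the context.
  total-cong f f-cong = sum-map-Permutation (weight f) (sum-map-Permutation f f-cong)

  #required #offered : θProp → ℕ
  #required = size ∘ required
  #offered  = size ∘ offered

  Solvent : List (Tensor θProp) → Set
  Solvent Θ = total #required Θ ≤ total #offered Θ

  ⊆⇒size≤ : ∀ δ δ′ → δ ⊆ δ′ → size δ ≤ size δ′
  ⊆⇒size≤ δ δ′ (δ″ , eq) =
    ≤-trans (m≤m+n _ _)
      (≤-reflexive (≡-trans (sym (weight-⊗ (const 1) δ δ″)) (size-cong (δ ⊗ δ″) δ′ eq)))

  -- Formulas enter `Δ` only as the single lollipop of `⊸-left`; merging by `⊗-left-Δ` and exchange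
  -- lose no factors.
  ⊢-nonEmpty : ∀ {Ω Θ Δ Σ σ} → Ω ⨟ Θ ∣ Δ ∣ Σ ⊢ σ → All ⟦_⟧ Ω → All NonEmpty Δ
  ⊢-nonEmpty (L-Exch πΩ _ πΔ _ _ d) γ             =
    All-resp-Permutation (λ {δ} {δ′} eq → subst (0 <_) (size-cong δ δ′ eq)) πΔ
      (⊢-nonEmpty d (⟦⟧-resp⁻ πΩ γ))
  ⊢-nonEmpty (L-Cont d)             (x ∷ γ)       = ⊢-nonEmpty d (x ∷ x ∷ γ)
  ⊢-nonEmpty (L-Weak d)             (_ ∷ γ)       = ⊢-nonEmpty d γ
  ⊢-nonEmpty (L-∧-left₁ d)          ((x , _) ∷ γ) = ⊢-nonEmpty d (x ∷ γ)
  ⊢-nonEmpty (L-∧-left₂ d)          ((_ , y) ∷ γ) = ⊢-nonEmpty d (y ∷ γ)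
  ⊢-nonEmpty (L-⇒-left {Ω} e d)     (f ∷ γ)       =
    let γ₁ , γ₂ = ++⁻ Ω γ in ⊢-nonEmpty d (f (⊩-sound e γ₁) ∷ γ₂)
  ⊢-nonEmpty I-right                _             = []
  ⊢-nonEmpty Σ-Ax                   _             = []
  ⊢-nonEmpty (⊗-left-Θ d)           γ             = ⊢-nonEmpty d γ
  ⊢-nonEmpty (⊗-left-Δ {x = x} {y = y} d) γ with ⊢-nonEmpty d γ
  ... | 0<x ∷ _ ∷ 0<Δ = nonEmpty-⊗ x y 0<x ∷ 0<Δ
  ⊢-nonEmpty (⊗-left-Σ d)           γ             = ⊢-nonEmpty d γ
  ⊢-nonEmpty (⊗-right d d′)         γ             = ++⁺ (⊢-nonEmpty d γ) (⊢-nonEmpty d′ γ)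
  ⊢-nonEmpty (⊸-left _)             _             = s≤s z≤n ∷ []
  ⊢-nonEmpty (⊸⊸-left _ d)          γ with ⊢-nonEmpty d γ
  ... | _ ∷ 0<Δ = 0<Δ
  ⊢-nonEmpty (⊸⊸-split d)           γ             = ⊢-nonEmpty d γ
  ⊢-nonEmpty (G-left-θ _)           (() ∷ _)
  ⊢-nonEmpty (G-left-δ _)           (() ∷ _)
  ⊢-nonEmpty (Ω-cut {Ω} e d)        γ             =
    let γ₁ , γ₂ = ++⁻ Ω γ in ⊢-nonEmpty d (⊩-sound e γ₁ ∷ γ₂)

  -- A contract enters `Θ` only by `⊸⊸-left`, whose inclusion bounds the required by the offered;
  -- `⊸⊸-split` and `⊗-left-Θ` keep both totals. `G-left-θ` could move a surplus out of `Θ` and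
  -- leave a debt, but a true `Ω` excludes it. Truth, unlike emptiness, passes to the premises of
  -- `Ω-cut`.
  ⊢-solvent : ∀ {Ω Θ Δ Σ σ} → Ω ⨟ Θ ∣ Δ ∣ Σ ⊢ σ → All ⟦_⟧ Ω → Solvent Θ
  ⊢-solvent (L-Exch πΩ πΘ _ _ _ d) γ             =
    subst₂ _≤_
      (total-cong #required (λ {θ} {θ′} (eq , _) → size-cong (required θ) (required θ′) eq) πΘ)
      (total-cong #offered (λ {θ} {θ′} (_ , eq) → size-cong (offered θ) (offered θ′) eq) πΘ)
      (⊢-solvent d (⟦⟧-resp⁻ πΩ γ))
  ⊢-solvent (L-Cont d)             (x ∷ γ)       = ⊢-solvent d (x ∷ x ∷ γ)
  ⊢-solvent (L-Weak d)             (_ ∷ γ)       = ⊢-solvent d γ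
  ⊢-solvent (L-∧-left₁ d)          ((x , _) ∷ γ) = ⊢-solvent d (x ∷ γ)
  ⊢-solvent (L-∧-left₂ d)          ((_ , y) ∷ γ) = ⊢-solvent d (y ∷ γ)
  ⊢-solvent (L-⇒-left {Ω} e d)     (f ∷ γ)       =
    let γ₁ , γ₂ = ++⁻ Ω γ in ⊢-solvent d (f (⊩-sound e γ₁) ∷ γ₂)
  ⊢-solvent I-right                _             = z≤n
  ⊢-solvent Σ-Ax                   _             = z≤n
  ⊢-solvent (⊗-left-Θ {Θ = Θ} {x = x} {y = y} d) γ =
    subst₂ _≤_ (total-⊗ #required x y Θ) (total-⊗ #offered x y Θ) (⊢-solvent d γ)
  ⊢-solvent (⊗-left-Δ d)           γ             = ⊢-solvent d γ
  ⊢-solvent (⊗-left-Σ d)           γ             = ⊢-solvent d γ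
  ⊢-solvent (⊗-right {Θ = Θ} {Θ′ = Θ′} d d′) γ   =
    subst₂ _≤_ (sym (sum-map-++ (weight #required) Θ Θ′))
               (sym (sum-map-++ (weight #offered) Θ Θ′))
      (+-mono-≤ (⊢-solvent d γ) (⊢-solvent d′ γ))
  ⊢-solvent (⊸-left _)             _             = z≤n
  ⊢-solvent (⊸⊸-left {δ = δ} {δ′} δ⊆δ′ d) γ   =
    -- The `0` ends the sum over the one-factor tensor `⟨ δ ⊸⊸ δ′ ⟩`.
    +-mono-≤ (+-monoˡ-≤ 0 (⊆⇒size≤ δ δ′ δ⊆δ′)) (⊢-solvent d γ)
  ⊢-solvent (⊸⊸-split {Θ = Θ} {δ = δ} {δ′} {δ″} {δ‴} d) γ =
    subst₂ _≤_ (total-merge #required θ₁ θ₂ θ Θ (weight-⊗ (const 1) δ δ″))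
               (total-merge #offered θ₁ θ₂ θ Θ (weight-⊗ (const 1) δ′ δ‴))
      (⊢-solvent d γ)
    where
    θ₁ = δ ⊸⊸ δ′
    θ₂ = δ″ ⊸⊸ δ‴
    θ  = (δ ⊗ δ″) ⊸⊸ (δ′ ⊗ δ‴)
  ⊢-solvent (G-left-θ _)           (() ∷ _)
  ⊢-solvent (G-left-δ _)           (() ∷ _)
  ⊢-solvent (Ω-cut {Ω} e d)        γ             =
    let γ₁ , γ₂ = ++⁻ Ω γ in ⊢-solvent d (⊩-sound e γ₁ ∷ γ₂)

  -- Usability of non-empty tensors of lollipops.

  sources-⊢-targets : ∀ ls →
    [] ⨟ [] ∣ map ⟨_⟩ ls ∣ map (⟨_⟩ ∘ source) ls ⊢ foldr _⊗_ I (map (⟨_⟩ ∘ target) ls)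
  sources-⊢-targets []       = I-right
  sources-⊢-targets (_ ∷ ls) = ⊗-right (⊸-left Σ-Ax) (sources-⊢-targets ls)

  -- `⊗-left-Δ` merges the two leading formulas, so a left-nested product is reached without
  -- exchange.
  ⊗-left-Δ* : ∀ {Ω Θ Σ σ} δ Δ →
              Ω ⨟ Θ ∣ δ ∷ Δ ∣ Σ ⊢ σ → Ω ⨟ Θ ∣ [ foldl _⊗_ δ Δ ] ∣ Σ ⊢ σ
  ⊗-left-Δ* δ []       d = d
  ⊗-left-Δ* δ (δ′ ∷ Δ) d = ⊗-left-Δ* (δ ⊗ δ′) Δ (⊗-left-Δ d)

  nonEmpty-usable : ∀ δ → NonEmpty δ → ∃[ Σ ] ∃[ σ ] ([] ⨟ [] ∣ [ δ ] ∣ Σ ⊢ σ)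
  nonEmpty-usable δ 0<δ with factors δ in eq
  -- `0<δ` rules out an empty list of factors. The fold starts from the factor `l`, as `I` cannot be
  -- introduced on the left.
  ... | l ∷ ls = _ , foldr _⊗_ I (map (⟨_⟩ ∘ target) (l ∷ ls)) ,
    L-Exch (refl []) (refl []) (refl (foldl≈δ ∷ []))
      (refl (Pointwise.refl (≡⇒Permutation ≡-refl))) (≡⇒Permutation ≡-refl)
      (⊗-left-Δ* ⟨ l ⟩ (map ⟨_⟩ ls) (sources-⊢-targets (l ∷ ls)))
    where
    foldl≈δ : foldl _⊗_ ⟨ l ⟩ (map ⟨_⟩ ls) ≈δ δ
    foldl≈δ = ≡⇒Permutation (≡-trans (factors-foldl-⊗ ⟨ l ⟩ ls) (sym eq))

  -- Contradiction for a complete and correct map.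

  module _ (m : HomomorphicMap) where
    open HomomorphicMap m

    mσ-id : ∀ σ → σ ≈σ mσ σ
    mσ-id I       = Homogeneous.sym sym mσ-I
    mσ-id ⟨ a ⟩   = Homogeneous.sym sym (mσ-atom _ _)
    mσ-id (s ⊗ t) = trans (Permutationₛ.++⁺ (setoid Atom) (mσ-id s) (mσ-id t))
                      (Homogeneous.sym sym (mσ-⊗ s t))

    -- Brings a sequent into the image form that `Correct` takes as hypothesis.
    ⊢-mσ : ∀ {Δ Σ σ} → [] ⨟ [] ∣ Δ ∣ Σ ⊢ σ → [] ⨟ [] ∣ Δ ∣ map mσ Σ ⊢ mσ σ
    ⊢-mσ {Σ = Σ} {σ} =
      L-Exch (refl []) (refl []) (refl (Pointwise.refl (≡⇒Permutation ≡-refl)))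
        (refl (images Σ)) (mσ-id σ)
      where
      images : ∀ Σ → Pointwise _≈σ_ Σ (map mσ Σ)
      images []      = []
      images (σ ∷ Σ) = mσ-id σ ∷ images Σ

    no-complete-correct : Atom → Complete m → Correct m → ⊥
    no-complete-correct a complete correct =
      let _ , σ , d = nonEmpty-usable (mθ debit) mθ-debit-nonEmpty
      in  debit-insolvent (⊢-solvent (correct [] [ debit ] [] _ σ (⊢-mσ d)) [])
      where
      l : δProp
      l = ⟨ a ⊸ a ⟩

      debit credit : θProp
      debit  = l ⊸⊸ I
      credit = I ⊸⊸ l

      debit-insolvent : ¬ Solvent [ ⟨ debit ⟩ ]
      debit-insolvent ()

      debit-credit : [] ⨟ map ⟨_⟩ (debit ∷ credit ∷ []) ∣ [] ∣ [ ⟨ a ⟩ ] ⊢ ⟨ a ⟩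
      debit-credit =
        -- The merged contract is `(l ⊗ I) ⊸⊸ (I ⊗ l)`. Both sides have the single factor `a ⊸ a`,
        -- so the inclusion has complement `I`, and exchange turns `I ⊗ l` into `l`.
        ⊸⊸-split (⊸⊸-left (I , ≡⇒Permutation ≡-refl)
          (L-Exch (refl []) (refl []) (refl (≡⇒Permutation ≡-refl ∷ []))
            (refl (≡⇒Permutation ≡-refl ∷ [])) (≡⇒Permutation ≡-refl)
            (⊸-left Σ-Ax)))

      mθ-debit-nonEmpty : NonEmpty (mθ debit)
      -- In the image sequent `mθ debit` and `mθ credit` make up the whole δ-context, `mθ debit`
      -- first.
      mθ-debit-nonEmpty with ⊢-nonEmpty (complete [] _ [] _ _ debit-credit) []
      ... | 0<debit ∷ _ = 0<debit

theorem5p14 : (Res Usr Pred : Set) (arity : Pred → ℕ) →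
    Finite Res → Finite Usr → Res → Usr →
    let open MuACL Res Usr Pred arity in
    ¬ (∃[ m ] (Complete m × Correct m))
theorem5p14 Res Usr Pred arity _ _ r u (m , complete , correct) =
  no-complete-correct m (r ＠ u) complete correct
  where open MuACL Res Usr Pred arity
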